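{- Let $(a_k)_{k\ge 0}$ and $(\lambda_k)_{k\ge 1}$ be complex numbers, and define $\mu_0=1$ and, for $n\ge 1$, $\mu_n=\sum_{\pi\in\mathcal{M}_n} v(\pi)$. Let $(c_n)_{n\ge1}$ be the free cumulants of $(\mu_n)$. Then for every $n\ge 2$, $$c_n=\sum_{\pi\in\mathcal{M}_n}\frac{(-1)^{|\pi|_0-1}}{n-1}\binom{n-1}{|\pi|_0}\,v(\pi).$$ (In particular the path consisting of $n$ horizontal steps contributes $0$, since then $|\pi|_0=n$.)
   Context: A Motzkin path of length $n$ is a sequence of integers $\pi=(\pi(0),\pi(1),\dots,\pi(n))$ with $\pi(0)=\pi(n)=0$, $\pi(i)\ge 0$ for all $i$, and $\pi(i)-\pi(i-1)\in\{1,0,-1\}$ for $i=1,\dots,n$ (rising, horizontal, falling step respectively). $\mathcal{M}_n$ denotes the set of Motzkin paths of length $n$. The valuation of a path is $v(\pi)=\prod_{i=1}^n v_i$, where $v_i=1$ if the $i$-th step rises, $v_i=a_{\pi(i-1)}$ if the $i$-th step is horizontal, and $v_i=\lambda_{\pi(i-1)}$ if the $i$-th step falls. $|\pi|_0$ denotes the number of returns to zero of $\pi$, i.e. the number of indices $i\in\{1,\dots,n\}$ with $\pi(i)=0$. Free cumulants: with $M(z)=1+\sum_{n\ge1}\mu_n z^n$ (formal power series), the free cumulants $c_n$ are the coefficients of the formal power series $C(z)=1+\sum_{n\ge1}c_nz^n$ uniquely determined by $C(zM(z))=M(z)$. -}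

module Defs where

open import Algebra.Bundles using (CommutativeRing; Semiring)
import Algebra.Definitions.RawSemiring as RawSemiringDefs
open import Data.Fin.Base using (Fin; zero; suc; toℕ; fromℕ; inject₁)
open import Data.List.Base using (List; []; _∷_; [_]; _++_; map; foldr)
open import Data.List.Membership.Propositional using (_∈_)
open import Data.List.Membership.Propositional.Properties
  using (∈-map⁺; ∈-map⁻; ∈-++⁺ˡ; ∈-++⁺ʳ; ∈-++⁻)
open import Data.List.Relation.Unary.Any using (here)
import Data.List.Relation.Unary.All as All
import Data.List.Relation.Unary.AllPairs as AllPairs
open import Data.List.Relation.Unary.Unique.Propositional using (Unique)
open import Data.List.Relation.Unary.Unique.Propositional.Properties using (map⁺; ++⁺)
open import Data.List.Properties using (map-++)
open import Data.Nat.Base as ℕ using (ℕ; zero; suc; _∸_; NonZero)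
open import Data.Nat.Combinatorics using (_C_)
open import Data.Nat.Properties using (_≟_; m<n⇒0<n∸m)
open import Data.Product.Base using (_,_)
open import Data.Sum.Base using (inj₁; inj₂)
open import Data.Vec.Base using (Vec; []; _∷_; lookup; tail; count)
open import Data.Vec.Properties using (∷-injectiveʳ)
open import Level using (_⊔_) renaming (suc to lsuc)
open import Relation.Nullary using (¬_)
open import Relation.Binary.PropositionalEquality
  using (_≡_; refl; sym; trans; cong₂; subst)

data Step : ℕ → ℕ → Set where
  rise       : ∀ {h} → Step h (suc h)
  horizontal : ∀ {h} → Step h h
  fall       : ∀ {h} → Step (suc h) h

-- The heights are non-negative integers, hence natural numbers.
-- The initial height is a parameter, to allow recursion on the length.

record PathFrom (h n : ℕ) : Set where
  constructor mkPath
  field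
    heights : Vec ℕ (suc n)

  π : Fin (suc n) → ℕ
  π = lookup heights

  field
    start : π zero ≡ h
    end   : π (fromℕ n) ≡ 0
    step  : (i : Fin n) → Step (π (inject₁ i)) (π (suc i))

open PathFrom public using (heights; π; step)

MotzkinPath : ℕ → Set
MotzkinPath = PathFrom 0

∣_∣₀ : ∀ {n} → MotzkinPath n → ℕ
∣ p ∣₀ = count (_≟ 0) (tail (heights p))

cons : ∀ {h h′ n} → Step h h′ → PathFrom h′ n → PathFrom h (suc n)
cons {h} {n = n} s (mkPath hs refl e st) = mkPath (h ∷ hs) refl e st′
  where
  st′ : (i : Fin (suc n)) → Step (lookup (h ∷ hs) (inject₁ i)) (lookup hs i)
  st′ zero    = s
  st′ (suc i) = st i

mutual
  pathsFrom : ∀ n h → List (PathFrom h n)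
  pathsFrom zero    zero    = [ mkPath (0 ∷ []) refl refl (λ ()) ]
  pathsFrom zero    (suc h) = []
  pathsFrom (suc n) h       =
    map (cons rise) (pathsFrom n (suc h)) ++
    map (cons horizontal) (pathsFrom n h) ++
    fallingFrom n h

  fallingFrom : ∀ n h → List (PathFrom h (suc n))
  fallingFrom n zero    = []
  fallingFrom n (suc h) = map (cons fall) (pathsFrom n h)

𝓜 : ∀ n → List (MotzkinPath n)
𝓜 n = pathsFrom n 0

-- 𝓜 n enumerates the Motzkin paths of length n, each exactly once: paths are
-- compared by their heights, which also determine the steps.

Step-irrelevant : ∀ {h h′} (s t : Step h h′) → s ≡ t
Step-irrelevant rise       rise       = refl
Step-irrelevant horizontal horizontal = refl
Step-irrelevant fall       fall       = refl

private
  heights-cons : ∀ {h h′ n} (s : Step h h′) (p : PathFrom h′ n) →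
                 heights (cons s p) ≡ h ∷ heights p
  heights-cons s (mkPath hs refl e st) = refl

  ∈-cons : ∀ {h h′ n} (s : Step h h′) {xs : Vec ℕ (suc n)} {ps} →
           xs ∈ map heights ps → (h ∷ xs) ∈ map heights (map (cons s) ps)
  ∈-cons s xs∈ with ∈-map⁻ heights xs∈
  ... | p , p∈ , refl =
    subst (_∈ _) (heights-cons s p) (∈-map⁺ heights (∈-map⁺ (cons s) p∈))

  ∈-++ˡ : ∀ {h n} {x : Vec ℕ (suc n)} (ps qs : List (PathFrom h n)) →
          x ∈ map heights ps → x ∈ map heights (ps ++ qs)
  ∈-++ˡ ps qs x∈ = subst (_ ∈_) (sym (map-++ heights ps qs)) (∈-++⁺ˡ x∈)

  ∈-++ʳ : ∀ {h n} {x : Vec ℕ (suc n)} (ps qs : List (PathFrom h n)) →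
          x ∈ map heights qs → x ∈ map heights (ps ++ qs)
  ∈-++ʳ ps qs x∈ =
    subst (_ ∈_) (sym (map-++ heights ps qs)) (∈-++⁺ʳ (map heights ps) x∈)

  pathsFrom-complete : ∀ {h} n (p : PathFrom h n) →
                       heights p ∈ map heights (pathsFrom n h)
  pathsFrom-complete zero (mkPath (.0 ∷ []) refl refl st) = here refl
  pathsFrom-complete {h} (suc n) (mkPath (.h ∷ h′ ∷ hs) refl e st) =
    go (st zero) (pathsFrom-complete n (mkPath (h′ ∷ hs) refl e (λ i → st (suc i))))
    where
    go : ∀ {h h′} → Step h h′ → (h′ ∷ hs) ∈ map heights (pathsFrom n h′) →
         (h ∷ h′ ∷ hs) ∈ map heights (pathsFrom (suc n) h)
    go {h} rise q = ∈-++ˡ (map (cons rise) (pathsFrom n (suc h))) _ (∈-cons rise q)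
    go {h} horizontal q =
      ∈-++ʳ (map (cons rise) (pathsFrom n (suc h))) _
        (∈-++ˡ (map (cons horizontal) (pathsFrom n h)) _ (∈-cons horizontal q))
    go {suc h} fall q =
      ∈-++ʳ (map (cons rise) (pathsFrom n (suc (suc h)))) _
        (∈-++ʳ (map (cons horizontal) (pathsFrom n (suc h))) _ (∈-cons fall q))

  map-cons : ∀ {h h′ n} (s : Step h h′) (ps : List (PathFrom h′ n)) →
             map heights (map (cons s) ps) ≡ map (h ∷_) (map heights ps)
  map-cons s []       = refl
  map-cons s (p ∷ ps) = cong₂ _∷_ (heights-cons s p) (map-cons s ps)

  cons-unique : ∀ {h h′ n} (s : Step h h′) (ps : List (PathFrom h′ n)) →
                Unique (map heights ps) → Unique (map heights (map (cons s) ps))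
  cons-unique s ps u =
    subst Unique (sym (map-cons s ps)) (map⁺ ∷-injectiveʳ u)

  second : ∀ {h h′ n x} (s : Step h h′) (ps : List (PathFrom h′ n)) →
           x ∈ map heights (map (cons s) ps) → lookup x (suc zero) ≡ h′
  second s ps x∈ with ∈-map⁻ heights x∈
  ... | _ , q∈ , refl with ∈-map⁻ (cons s) q∈
  ...   | mkPath hs refl e st , _ , refl = refl

  ++-unique : ∀ {h n} (ps qs : List (PathFrom h n)) →
              Unique (map heights ps) → Unique (map heights qs) →
              (∀ {x} → x ∈ map heights ps → ¬ x ∈ map heights qs) →
              Unique (map heights (ps ++ qs))
  ++-unique ps qs u v d =
    subst Unique (sym (map-++ heights ps qs)) (++⁺ u v (λ (a , b) → d a b))

  n≢1+n : ∀ {n} → ¬ (n ≡ ℕ.suc n)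
  n≢1+n ()

  n≢2+n : ∀ {n} → ¬ (n ≡ ℕ.suc (ℕ.suc n))
  n≢2+n ()

  pathsFrom-unique : ∀ n h → Unique (map heights (pathsFrom n h))
  pathsFrom-unique zero    zero    = All.[] AllPairs.∷ AllPairs.[]
  pathsFrom-unique zero    (suc h) = AllPairs.[]
  pathsFrom-unique (suc n) zero    =
    ++-unique R (H ++ []) (cons-unique rise _ (pathsFrom-unique n 1))
      (++-unique H [] (cons-unique horizontal _ (pathsFrom-unique n 0)) AllPairs.[] (λ _ ()))
      R∩H
    where
    R = map (cons rise) (pathsFrom n 1)
    H = map (cons horizontal) (pathsFrom n 0)
    R∩H : ∀ {x} → x ∈ map heights R → ¬ x ∈ map heights (H ++ [])
    R∩H x∈R x∈ with ∈-++⁻ (map heights H) (subst (_ ∈_) (map-++ heights H []) x∈)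
    ... | inj₁ x∈H = n≢1+n (trans (sym (second horizontal _ x∈H)) (second rise _ x∈R))
  pathsFrom-unique (suc n) (suc h) =
    ++-unique R (H ++ F) (cons-unique rise _ (pathsFrom-unique n (suc (suc h))))
      (++-unique H F (cons-unique horizontal _ (pathsFrom-unique n (suc h)))
                     (cons-unique fall _ (pathsFrom-unique n h)) H∩F)
      R∩HF
    where
    R = map (cons rise) (pathsFrom n (suc (suc h)))
    H = map (cons horizontal) (pathsFrom n (suc h))
    F = map (cons fall) (pathsFrom n h)
    H∩F : ∀ {x} → x ∈ map heights H → ¬ x ∈ map heights F
    H∩F x∈H x∈F = n≢1+n (trans (sym (second fall _ x∈F)) (second horizontal _ x∈H))
    R∩HF : ∀ {x} → x ∈ map heights R → ¬ x ∈ map heights (H ++ F)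
    R∩HF x∈R x∈ with ∈-++⁻ (map heights H) (subst (_ ∈_) (map-++ heights H F) x∈)
    ... | inj₁ x∈H = n≢1+n (trans (sym (second horizontal _ x∈H)) (second rise _ x∈R))
    ... | inj₂ x∈F = n≢2+n (trans (sym (second fall _ x∈F)) (second rise _ x∈R))

𝓜-complete : ∀ {n} (p : MotzkinPath n) → heights p ∈ map heights (𝓜 n)
𝓜-complete = pathsFrom-complete _

𝓜-unique : ∀ n → Unique (map heights (𝓜 n))
𝓜-unique n = pathsFrom-unique n 0

-- A commutative ring in which every positive integer is invertible, i.e. a
-- commutative ℚ-algebra.  The field of complex numbers is an instance.

record RationalAlgebra c ℓ : Set (lsuc (c ⊔ ℓ)) where
  field
    commutativeRing : CommutativeRing c ℓ

  open CommutativeRing commutativeRing public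
  open RawSemiringDefs (Semiring.rawSemiring semiring) public using (_×_; _^_; sum; product)

  field
    recip         : (n : ℕ) → .{{NonZero n}} → Carrier
    recip-inverse : (n : ℕ) .{{_ : NonZero n}} → (n × 1#) * recip n ≈ 1#

module _ {c ℓ} (K : RationalAlgebra c ℓ) where
  open RationalAlgebra K

  -- Formal power series, f n being the coefficient of zⁿ.

  Series : Set c
  Series = ℕ → Carrier

  -- 1 + Σ_{n≥1} x_n zⁿ; the value x 0 is ignored.

  1+Σ : (ℕ → Carrier) → Series
  1+Σ x zero    = 1#
  1+Σ x (suc n) = x (suc n)

  z·_ : Series → Series
  (z· f) zero    = 0#
  (z· f) (suc n) = f n

  _⊛_ : Series → Series → Series
  (f ⊛ g) n = sum {suc n} λ i → f (toℕ i) * g (n ∸ toℕ i)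

  oneₛ : Series
  oneₛ zero    = 1#
  oneₛ (suc _) = 0#

  _^ₛ_ : Series → ℕ → Series
  f ^ₛ zero  = oneₛ
  f ^ₛ suc k = f ⊛ (f ^ₛ k)

  -- f(z g(z)) = Σ_k f_k (z g(z))ᵏ, where (z g(z))ᵏ has no terms of degree
  -- below k, so that only k ≤ n contributes to the coefficient of zⁿ.

  _∘z·_ : Series → Series → Series
  (f ∘z· g) n = sum {suc n} λ k → f (toℕ k) * ((z· g) ^ₛ toℕ k) n

  -- C(z M(z)) = M(z).  This triangular system determines the cₙ with n ≥ 1; the
  -- value c 0 is irrelevant.

  FreeCumulants : (μ c : ℕ → Carrier) → Set ℓ
  FreeCumulants μ c = ∀ n → (1+Σ c ∘z· 1+Σ μ) n ≈ 1+Σ μ n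

  Σ𝓜 : (n : ℕ) → (MotzkinPath n → Carrier) → Carrier
  Σ𝓜 n f = foldr _+_ 0# (map f (𝓜 n))

  module _ (a : ℕ → Carrier) (lam : (k : ℕ) → .{{NonZero k}} → Carrier) where

    weight : ∀ {h h′} → Step h h′ → Carrier
    weight rise             = 1#
    weight (horizontal {h}) = a h
    weight (fall {h})       = lam (suc h)

    v : ∀ {n} → MotzkinPath n → Carrier
    v {n} p = product {n} λ i → weight (step p i)

    μ : ℕ → Carrier
    μ zero      = 1#
    μ n@(suc _) = Σ𝓜 n v

  -- (-1)^{r-1}/(n-1) · binom(n-1, r) for n ≥ 2.  In the intended use r is the
  -- number of returns of a path of positive length, so r ≥ 1 and the
  -- truncated subtraction r ∸ 1 is exact.

  coefficient : (n : ℕ) → 1 ℕ.< n → ℕ → Carrier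
  coefficient n 1<n r =
    ((- 1#) ^ (r ∸ 1)) * recip (n ∸ 1) {{ℕ.>-nonZero (m<n⇒0<n∸m 1<n)}}
      * (((n ∸ 1) C r) × 1#)

-- A path with r returns is a concatenation of r paths without intermediate
-- returns, so with P the generating function of the latter, M = 1 / (1 − P) and
-- the weighted paths with r returns are counted by Pʳ.  Writing Q = 1 − P = M⁻¹,
-- the binomial theorem turns the right-hand side into − [zⁿ] Qⁿ⁻¹ / (n − 1).
--
-- That this is cₙ is Lagrange inversion.  Put θ = z d/dz, T = M θQ and
-- Xₘ = Qᵐ (1 − T).  Since θ(Qᵐ) = m Qᵐ T, one gets m Xₘ = m Qᵐ − θ(Qᵐ), hence
-- [zᵐ] Xₘ = 0 for m ≥ 1, while [z⁰] X₀ = 1; the recursion M Xₘ₊₁ = Xₘ then yields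
-- [zᵐ] C(zM) Xₘ = cₘ.  As C(zM) Xₙ = M Xₙ = Xₙ₋₁, finally
-- (n − 1) cₙ = (n − 1 − n) [zⁿ] Qⁿ⁻¹.

module Submission where

open import Algebra.Bundles using (CommutativeRing)
import Algebra.Construct.Pointwise as Pointwise
import Algebra.Properties.Ring as RingProperties
import Algebra.Properties.Semiring.Mult as SemiringMult
import Algebra.Properties.CommutativeMonoid.Mult as CommutativeMonoidMult
import Algebra.Solver.Ring.NaturalCoefficients.Default as NatSolver
open import Data.Fin.Base using (toℕ)
open import Data.List.Base using (List; []; _∷_; map; foldr; _++_)
open import Data.Nat.Base as ℕ using (ℕ; zero; suc; _≤_; _<_; z≤n; s≤s; z<s; NonZero)
open import Data.Nat.Combinatorics using (_C_; k>n⇒nCk≡0; nCk+nC[k+1]≡[n+1]C[k+1])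
import Data.Nat.Properties as ℕ
open import Data.Product.Base using (_,_)
open import Data.Vec.Base using (_∷_; tail; count)
open import Function.Base using (_∘_; const)
import Relation.Binary.PropositionalEquality.Core as ≡
import Relation.Binary.Reasoning.Setoid as SetoidReasoning
open import Defs

-- Formal power series as a commutative ring.

module PowerSeries {ℓ₁ ℓ₂} (K : RationalAlgebra ℓ₁ ℓ₂) where
  open RationalAlgebra K hiding (zero)
  open SemiringMult semiring using (×-congʳ; ×-comm-*; ×-assoc-*)
  open CommutativeMonoidMult +-commutativeMonoid using (×-distrib-+)
  open RingProperties ring using (-‿distribʳ-*; -0#≈0#; +-identityˡ-unique; +-inverseˡ-unique)
  open NatSolver commutativeSemiring
  open SetoidReasoning setoid

  infixl 7 _∗_ _·_
  infixl 6 _⊕_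
  infix  4 _≋_

  _∗_ : Series K → Series K → Series K
  _∗_ = _⊛_ K

  1ₛ : Series K
  1ₛ = oneₛ K

  _⊕_ : Series K → Series K → Series K
  (f ⊕ g) n = f n + g n

  _·_ : Carrier → Series K → Series K
  (x · f) n = x * f n

  _≋_ : Series K → Series K → Set ℓ₂
  f ≋ g = ∀ n → f n ≈ g n

  -- Truncated compositions agree in low degrees only, so a bounded congruence is needed. The
  -- induction rests on `(f ∗ g) (suc n)` unfolding to `f 0 * g (suc n) + ((f ∘ suc) ∗ g) n`, as do
  -- several below.
  ∗-cong-≤ : ∀ n {f f′ g g′} → (∀ i → i ≤ n → f i ≈ f′ i) → (∀ i → i ≤ n → g i ≈ g′ i) →
             (f ∗ g) n ≈ (f′ ∗ g′) n
  ∗-cong-≤ zero    p q = +-congʳ (*-cong (p 0 z≤n) (q 0 z≤n))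
  ∗-cong-≤ (suc n) p q =
    +-cong (*-cong (p 0 z≤n) (q (suc n) ℕ.≤-refl))
           (∗-cong-≤ n (λ i i≤n → p (suc i) (s≤s i≤n)) (λ i i≤n → q i (ℕ.m≤n⇒m≤1+n i≤n)))

  ∗-cong : ∀ {f f′ g g′} → f ≋ f′ → g ≋ g′ → f ∗ g ≋ f′ ∗ g′
  ∗-cong p q n = ∗-cong-≤ n (λ i _ → p i) (λ i _ → q i)

  ∗-distribʳ : ∀ h f g → (f ⊕ g) ∗ h ≋ f ∗ h ⊕ g ∗ h
  ∗-distribʳ h f g zero    = solve 3 (λ a b c → (a :+ b) :* c :+ con 0 :=
    (a :* c :+ con 0) :+ (b :* c :+ con 0)) refl (f 0) (g 0) (h 0)
  ∗-distribʳ h f g (suc n) = begin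
    (f 0 + g 0) * h (suc n) + ((f ∘ suc ⊕ g ∘ suc) ∗ h) n
      ≈⟨ +-congˡ (∗-distribʳ h (f ∘ suc) (g ∘ suc) n) ⟩
    (f 0 + g 0) * h (suc n) + (((f ∘ suc) ∗ h) n + ((g ∘ suc) ∗ h) n)
      ≈⟨ solve 5 (λ a b c d e → (a :+ b) :* c :+ (d :+ e) := (a :* c :+ d) :+ (b :* c :+ e))
           refl (f 0) (g 0) (h (suc n)) _ _ ⟩
    (f ∗ h ⊕ g ∗ h) (suc n) ∎

  ·-∗-assoc : ∀ x f g → (x · f) ∗ g ≋ x · (f ∗ g)
  ·-∗-assoc x f g zero    = solve 3 (λ a b c → a :* b :* c :+ con 0 := a :* (b :* c :+ con 0))
    refl x (f 0) (g 0)
  ·-∗-assoc x f g (suc n) = begin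
    x * f 0 * g (suc n) + ((x · (f ∘ suc)) ∗ g) n  ≈⟨ +-congˡ (·-∗-assoc x (f ∘ suc) g n) ⟩
    x * f 0 * g (suc n) + x * ((f ∘ suc) ∗ g) n
      ≈⟨ solve 4 (λ a b c d → a :* b :* c :+ a :* d := a :* (b :* c :+ d))
           refl x (f 0) (g (suc n)) _ ⟩
    (x · (f ∗ g)) (suc n) ∎

  -- The product unfolds at its first summand; splitting off the last one gives the mirror image
  -- that commutativity needs.
  ∗-sucʳ : ∀ f g n → (f ∗ g) (suc n) ≈ (f ∗ (g ∘ suc)) n + f (suc n) * g 0
  ∗-sucʳ f g zero    = solve 4 (λ a b c d → a :* d :+ (b :* c :+ con 0) :=
    (a :* d :+ con 0) :+ b :* c) refl (f 0) (f 1) (g 0) (g 1)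
  ∗-sucʳ f g (suc n) = trans (+-congˡ (∗-sucʳ (f ∘ suc) g n)) (sym (+-assoc _ _ _))

  ∗-comm : ∀ f g → f ∗ g ≋ g ∗ f
  ∗-comm f g zero    = +-congʳ (*-comm _ _)
  ∗-comm f g (suc n) = begin
    f 0 * g (suc n) + ((f ∘ suc) ∗ g) n  ≈⟨ +-cong (*-comm _ _) (∗-comm (f ∘ suc) g n) ⟩
    g (suc n) * f 0 + (g ∗ (f ∘ suc)) n  ≈⟨ +-comm _ _ ⟩
    (g ∗ (f ∘ suc)) n + g (suc n) * f 0  ≈⟨ ∗-sucʳ g f n ⟨
    (g ∗ f) (suc n)                      ∎

  ∗-assoc : ∀ f g h → f ∗ g ∗ h ≋ f ∗ (g ∗ h)
  ∗-assoc f g h zero    = solve 3 (λ a b c → (a :* b :+ con 0) :* c :+ con 0 :=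
    a :* (b :* c :+ con 0) :+ con 0) refl (f 0) (g 0) (h 0)
  ∗-assoc f g h (suc n) = begin
    -- By definition `(f ∗ g) ∘ suc` is `f 0 · (g ∘ suc) ⊕ (f ∘ suc) ∗ g`.
    (f 0 * g 0 + 0#) * h (suc n) + ((f 0 · (g ∘ suc) ⊕ (f ∘ suc) ∗ g) ∗ h) n
      ≈⟨ +-cong (*-congʳ (+-identityʳ _)) (∗-distribʳ h (f 0 · (g ∘ suc)) ((f ∘ suc) ∗ g) n) ⟩
    f 0 * g 0 * h (suc n) + (((f 0 · (g ∘ suc)) ∗ h) n + ((f ∘ suc) ∗ g ∗ h) n)
      ≈⟨ +-congˡ (+-cong (·-∗-assoc (f 0) (g ∘ suc) h n) (∗-assoc (f ∘ suc) g h n)) ⟩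
    f 0 * g 0 * h (suc n) + (f 0 * ((g ∘ suc) ∗ h) n + ((f ∘ suc) ∗ (g ∗ h)) n)
      ≈⟨ solve 5 (λ a b c d e → a :* b :* c :+ (a :* d :+ e) := a :* (b :* c :+ d) :+ e)
           refl (f 0) (g 0) (h (suc n)) _ _ ⟩
    (f ∗ (g ∗ h)) (suc n) ∎

  ∗-zeroˡ : ∀ {f} g → (∀ n → f n ≈ 0#) → ∀ n → (f ∗ g) n ≈ 0#
  ∗-zeroˡ g f≈0 zero    = trans (+-identityʳ _) (trans (*-congʳ (f≈0 0)) (zeroˡ _))
  ∗-zeroˡ g f≈0 (suc n) = trans
    (+-cong (trans (*-congʳ (f≈0 0)) (zeroˡ _)) (∗-zeroˡ g (f≈0 ∘ suc) n)) (+-identityʳ _)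

  ∗-identityˡ : ∀ f → 1ₛ ∗ f ≋ f
  ∗-identityˡ f zero    = trans (+-identityʳ _) (*-identityˡ _)
  ∗-identityˡ f (suc n) = trans (+-cong (*-identityˡ _) (∗-zeroˡ f (λ _ → refl) n)) (+-identityʳ _)

  seriesRing : CommutativeRing ℓ₁ ℓ₂
  seriesRing = record
    { Carrier = Series K
    ; _≈_     = _≋_
    ; _+_     = _⊕_
    ; _*_     = _∗_
    ; -_      = λ f n → - f n
    ; 0#      = const 0#
    ; 1#      = 1ₛ
    ; isCommutativeRing = record
      { isRing = record
        { +-isAbelianGroup = Pointwise.isAbelianGroup ℕ +-isAbelianGroup
        ; *-cong           = ∗-cong
        ; *-assoc          = ∗-assoc
        ; *-identity       = ∗-identityˡ , λ f n → trans (∗-comm f 1ₛ n) (∗-identityˡ f n)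
        ; distrib          = (λ h f g n → trans (∗-comm h (f ⊕ g) n)
                               (trans (∗-distribʳ h f g n) (+-cong (∗-comm f h n) (∗-comm g h n))))
                           , ∗-distribʳ
        }
      ; *-comm = ∗-comm
      }
    }

  module S where
    open CommutativeRing seriesRing public
    open SemiringMult (CommutativeRing.semiring seriesRing) public using (_×_; ×-comm-*; ×-congʳ)
    open RingProperties (CommutativeRing.ring seriesRing) public
      using ([y-z]x≈yx-zx; x[y-z]≈xy-xz)

  ×-coefficient : ∀ k f n → (k S.× f) n ≈ k × f n
  ×-coefficient zero    f n = refl
  ×-coefficient (suc k) f n = +-congˡ (×-coefficient k f n)

  z·-∗-zero : ∀ f g → ((z·_ K f) ∗ g) 0 ≈ 0#
  z·-∗-zero f g = trans (+-identityʳ _) (zeroˡ _)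

  z·-∗-suc : ∀ f g n → ((z·_ K f) ∗ g) (suc n) ≈ (f ∗ g) n
  z·-∗-suc f g n = trans (+-congʳ (zeroˡ _)) (+-identityˡ _)

  -- The Euler derivation.

  θ : Series K → Series K
  θ f n = n × f n

  θ-∗ : ∀ f g → θ (f ∗ g) ≋ θ f ∗ g ⊕ f ∗ θ g
  θ-∗ f g zero    = solve 2 (λ a b → con 0 :=
    (con 0 :* b :+ con 0) :+ (a :* con 0 :+ con 0)) refl (f 0) (g 0)
  θ-∗ f g (suc n) = begin
    suc n × (f 0 * g (suc n) + (f′ ∗ g) n)
      ≈⟨ ×-distrib-+ _ _ (suc n) ⟩
    suc n × (f 0 * g (suc n)) + ((f′ ∗ g) n + θ (f′ ∗ g) n)
      ≈⟨ +-cong (sym (×-comm-* (suc n) _ _)) (+-congˡ (θ-∗ f′ g n)) ⟩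
    f 0 * θ g (suc n) + ((f′ ∗ g) n + ((θ f′ ∗ g) n + (f′ ∗ θ g) n))
      ≈⟨ solve 5 (λ a b c d e → a :+ (b :+ (c :+ d)) := (con 0 :* e :+ (b :+ c)) :+ (a :+ d))
           refl _ _ _ _ (g (suc n)) ⟩
    (0# * g (suc n) + ((f′ ∗ g) n + (θ f′ ∗ g) n)) + (f 0 * θ g (suc n) + (f′ ∗ θ g) n)
      -- By definition `θ f ∘ suc` is `f′ ⊕ θ f′`; the summand `f′` absorbs the surplus copy of
      -- `f′ ∗ g` left by `suc n × x = x + n × x`.
      ≈⟨ +-congʳ (+-congˡ (∗-distribʳ g f′ (θ f′) n)) ⟨
    (θ f ∗ g ⊕ f ∗ θ g) (suc n) ∎
    where f′ = f ∘ suc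

  -- Powers, division by integers and truncated composition.

  infixr 8 _↑_

  _↑_ : Series K → ℕ → Series K
  _↑_ = _^ₛ_ K

  ×-zeroʳ : ∀ n → n × 0# ≈ 0#
  ×-zeroʳ zero    = refl
  ×-zeroʳ (suc n) = trans (+-identityˡ _) (×-zeroʳ n)

  -- The invertibility of positive integers enters the argument only here.
  ×-cancel : ∀ n .{{_ : NonZero n}} {x y} → n × x ≈ y → x ≈ recip n * y
  ×-cancel n {x} {y} nx≈y = begin
    x                         ≈⟨ *-identityˡ x ⟨
    1# * x                    ≈⟨ *-congʳ (recip-inverse n) ⟨
    (n × 1#) * recip n * x    ≈⟨ solve 3 (λ a b c → a :* b :* c := b :* (a :* c)) refl _ _ _ ⟩
    recip n * ((n × 1#) * x)  ≈⟨ *-congˡ (×-assoc-* n 1# x) ⟩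
    recip n * (n × (1# * x))  ≈⟨ *-congˡ (×-congʳ n (*-identityˡ x)) ⟩
    recip n * (n × x)         ≈⟨ *-congˡ nx≈y ⟩
    recip n * y               ∎

  -- The cut-off `N` does not depend on the degree, so this is a finite combination of series, open
  -- to the ring laws. In degree `n`, `_∘z·_` is the case `N = suc n`.
  partialComposition : ℕ → Series K → Series K → Series K
  partialComposition N c f n = sum {N} λ k → c (toℕ k) * (f ↑ toℕ k) n

  ∗-distribˡ-sum : ∀ N f (c : Series K) (g : ℕ → Series K) →
                   f ∗ (λ n → sum {N} λ k → c (toℕ k) * g (toℕ k) n) ≋
                   λ n → sum {N} λ k → c (toℕ k) * (f ∗ g (toℕ k)) n
  ∗-distribˡ-sum zero    f c g n = trans (∗-comm f _ n) (∗-zeroˡ f (λ _ → refl) n)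
  ∗-distribˡ-sum (suc N) f c g n = begin
    (f ∗ (c 0 · g 0 ⊕ rest)) n         ≈⟨ S.distribˡ f (c 0 · g 0) rest n ⟩
    (f ∗ (c 0 · g 0)) n + (f ∗ rest) n
      ≈⟨ +-cong (trans (∗-comm f (c 0 · g 0) n)
           (trans (·-∗-assoc (c 0) (g 0) f n) (*-congˡ (∗-comm (g 0) f n))))
           (∗-distribˡ-sum N f (c ∘ suc) (g ∘ suc) n) ⟩
    c 0 * (f ∗ g 0) n + (sum {N} λ k → c (suc (toℕ k)) * (f ∗ g (suc (toℕ k))) n) ∎
    where rest = λ n → sum {N} λ k → c (suc (toℕ k)) * g (suc (toℕ k)) n

  -- Horner's rule: the powers from the first on share a factor `f`.
  partialComposition-suc : ∀ N c f → partialComposition (suc N) c f ≋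
                           c 0 · 1ₛ ⊕ f ∗ partialComposition N (c ∘ suc) f
  partialComposition-suc N c f n = +-congˡ (sym (∗-distribˡ-sum N f (c ∘ suc) (f ↑_) n))

  -- The k-th power of `z·_ K f` starts in degree k, so every cut-off above `n` gives the same
  -- coefficient. In the induction, the factor z in Horner's rule lowers the degree and the cut-offs
  -- by one.
  partialComposition-stable : ∀ {N N′ n} c f → n < N → n < N′ →
                              partialComposition N c (z·_ K f) n ≈
                              partialComposition N′ c (z·_ K f) n
  partialComposition-stable {suc N} {suc N′} {n} c f (s≤s n≤N) (s≤s n≤N′) = begin
    partialComposition (suc N) c zf n   ≈⟨ partialComposition-suc N c zf n ⟩
    c 0 * 1ₛ n + (zf ∗ G) n             ≈⟨ +-congˡ (zf∗G-stable n n≤N n≤N′) ⟩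
    c 0 * 1ₛ n + (zf ∗ G′) n            ≈⟨ partialComposition-suc N′ c zf n ⟨
    partialComposition (suc N′) c zf n  ∎
    where
    zf = z·_ K f
    G  = partialComposition N (c ∘ suc) zf
    G′ = partialComposition N′ (c ∘ suc) zf
    zf∗G-stable : ∀ n → n ≤ N → n ≤ N′ → (zf ∗ G) n ≈ (zf ∗ G′) n
    zf∗G-stable zero    _   _    = trans (z·-∗-zero f G) (sym (z·-∗-zero f G′))
    zf∗G-stable (suc n) n<N n<N′ = begin
      (zf ∗ G) (suc n)   ≈⟨ z·-∗-suc f G n ⟩
      (f ∗ G) n
        ≈⟨ ∗-cong-≤ n {f} {f} {G} {G′} (λ _ _ → refl) (λ i i≤n →
             partialComposition-stable (c ∘ suc) f (ℕ.≤-<-trans i≤n n<N) (ℕ.≤-<-trans i≤n n<N′)) ⟩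
      (f ∗ G′) n         ≈⟨ z·-∗-suc f G′ n ⟨
      (zf ∗ G′) (suc n)  ∎

  -- Lagrange inversion.

  module LagrangeInversion (M Q : Series K) (Q∗M≋1 : Q ∗ M ≋ 1ₛ) where
    -- The logarithmic derivative `θ Q / Q`, as `M` inverts `Q`.
    T : Series K
    T = M ∗ θ Q

    Q∗T≋θQ : Q ∗ T ≋ θ Q
    Q∗T≋θQ = S.trans (S.sym (S.*-assoc Q M (θ Q)))
      (S.trans (S.*-congʳ {θ Q} Q∗M≋1) (S.*-identityˡ (θ Q)))

    -- Iterated product rule. Writing `θ Q` as `Q ∗ T` keeps the exponent at `m`, so no predecessor
    -- of `m` appears.
    θ-↑ : ∀ m → θ (Q ↑ m) ≋ m S.× (Q ↑ m ∗ T)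
    θ-↑ zero    zero    = refl
    θ-↑ zero    (suc n) = ×-zeroʳ (suc n)
    θ-↑ (suc m) n = begin
      θ (Q ∗ Q ↑ m) n                           ≈⟨ θ-∗ Q (Q ↑ m) n ⟩
      (θ Q ∗ Q ↑ m ⊕ Q ∗ θ (Q ↑ m)) n
        ≈⟨ S.+-cong (S.*-congʳ {Q ↑ m} (S.sym Q∗T≋θQ)) (S.*-congˡ {Q} (θ-↑ m)) n ⟩
      (Q ∗ T ∗ Q ↑ m ⊕ Q ∗ (m S.× (Q ↑ m ∗ T))) n
        ≈⟨ S.+-cong (swap Q T (Q ↑ m)) (S.×-comm-* m Q (Q ↑ m ∗ T)) n ⟩
      (Q ↑ suc m ∗ T ⊕ m S.× (Q ∗ (Q ↑ m ∗ T))) n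
        ≈⟨ S.+-congˡ {Q ↑ suc m ∗ T} (S.×-congʳ m (S.sym (S.*-assoc Q (Q ↑ m) T))) n ⟩
      (suc m S.× (Q ↑ suc m ∗ T)) n             ∎
      where
      swap : ∀ f g h → f ∗ g ∗ h ≋ f ∗ h ∗ g
      swap f g h = S.trans (S.*-assoc f g h)
        (S.trans (S.*-congˡ {f} (S.*-comm g h)) (S.sym (S.*-assoc f h g)))

    X : ℕ → Series K
    X m = Q ↑ m ∗ (1ₛ S.- T)

    X-decomposition : ∀ m → X m ⊕ Q ↑ m ∗ T ≋ Q ↑ m
    X-decomposition m = S.trans (S.sym (S.distribˡ (Q ↑ m) (1ₛ S.- T) T))
      (S.trans (S.*-congˡ {Q ↑ m} (λ n → trans (+-assoc _ _ _)
        (trans (+-congˡ (-‿inverseˡ _)) (+-identityʳ _)))) (S.*-identityʳ (Q ↑ m)))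

    -- A subtraction-free form of `m Xₘ = m Qᵐ − θ(Qᵐ)`. For positive `m`, the case `n = m` makes
    -- the diagonal coefficient of `X` vanish, and `n = suc m` yields the coefficient in the final
    -- formula.
    X-coefficient : ∀ m n → m × X m n + n × (Q ↑ m) n ≈ m × (Q ↑ m) n
    X-coefficient m n = begin
      m × X m n + n × (Q ↑ m) n
        ≈⟨ +-congˡ (trans (θ-↑ m n) (×-coefficient m (Q ↑ m ∗ T) n)) ⟩
      m × X m n + m × (Q ↑ m ∗ T) n    ≈⟨ ×-distrib-+ _ _ m ⟨
      m × (X m n + (Q ↑ m ∗ T) n)      ≈⟨ ×-congʳ m (X-decomposition m n) ⟩
      m × (Q ↑ m) n                    ∎

    -- `θ` kills the constant term of `Q`, so `T` has none.
    X-diagonal-zero : X 0 0 ≈ 1#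
    X-diagonal-zero = begin
      X 0 0                              ≈⟨ +-identityʳ _ ⟩
      1# * (1# - (M 0 * 0# + 0#))        ≈⟨ *-identityˡ _ ⟩
      1# - (M 0 * 0# + 0#)               ≈⟨ +-congˡ (-‿cong (trans (+-identityʳ _) (zeroʳ _))) ⟩
      1# - 0#                            ≈⟨ +-congˡ -0#≈0# ⟩
      1# + 0#                            ≈⟨ +-identityʳ _ ⟩
      1#                                 ∎

    X-diagonal-suc : ∀ m → X (suc m) (suc m) ≈ 0#
    X-diagonal-suc m = trans
      (×-cancel (suc m) (+-identityˡ-unique _ _ (X-coefficient (suc m) (suc m)))) (zeroʳ _)

    M∗X-suc : ∀ m → M ∗ X (suc m) ≋ X m
    M∗X-suc m n = begin
      (M ∗ (Q ∗ Q ↑ m ∗ Y)) n     ≈⟨ S.*-congˡ {M} (S.*-assoc Q (Q ↑ m) Y) n ⟩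
      (M ∗ (Q ∗ (Q ↑ m ∗ Y))) n   ≈⟨ S.*-assoc M Q (Q ↑ m ∗ Y) n ⟨
      (M ∗ Q ∗ X m) n             ≈⟨ S.*-congʳ {X m} (S.trans (S.*-comm M Q) Q∗M≋1) n ⟩
      (1ₛ ∗ X m) n                ≈⟨ S.*-identityˡ (X m) n ⟩
      X m n                       ∎
      where Y = 1ₛ S.- T

    -- Under Horner's rule `c 0` meets a diagonal coefficient of `X`, which is zero unless `m` is.
    -- In the other term z lowers the degree and `M` lowers the index of `X`, so the diagonal is
    -- kept and the claim recurs for `c ∘ suc`.
    coefficient-extraction : ∀ m {N} c → m < N → (partialComposition N c (z·_ K M) ∗ X m) m ≈ c m
    coefficient-extraction m {suc N} c (s≤s m≤N) = begin
      (partialComposition (suc N) c zM ∗ X m) m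
        ≈⟨ S.*-congʳ {X m} (partialComposition-suc N c zM) m ⟩
      ((c 0 · 1ₛ ⊕ zM ∗ G) ∗ X m) m
        ≈⟨ S.distribʳ (X m) (c 0 · 1ₛ) (zM ∗ G) m ⟩
      ((c 0 · 1ₛ) ∗ X m) m + (zM ∗ G ∗ X m) m
        ≈⟨ +-cong (trans (·-∗-assoc (c 0) 1ₛ (X m) m) (*-congˡ (S.*-identityˡ (X m) m)))
             (S.*-assoc zM G (X m) m) ⟩
      c 0 * X m m + (zM ∗ (G ∗ X m)) m
        ≈⟨ diagonal m m≤N ⟩
      c m ∎
      where
      zM = z·_ K M
      G  = partialComposition N (c ∘ suc) zM
      diagonal : ∀ m → m ≤ N → c 0 * X m m + (zM ∗ (G ∗ X m)) m ≈ c m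
      diagonal zero    _   = trans (+-cong (trans (*-congˡ X-diagonal-zero) (*-identityʳ _))
                                           (z·-∗-zero M (G ∗ X 0))) (+-identityʳ _)
      diagonal (suc m) m<N = begin
        c 0 * X (suc m) (suc m) + (zM ∗ (G ∗ X (suc m))) (suc m)
          ≈⟨ +-cong (trans (*-congˡ (X-diagonal-suc m)) (zeroʳ _)) (z·-∗-suc M (G ∗ X (suc m)) m) ⟩
        0# + (M ∗ (G ∗ X (suc m))) m
          ≈⟨ +-identityˡ _ ⟩
        (M ∗ (G ∗ X (suc m))) m
          ≈⟨ S.trans (S.sym (S.*-assoc M G (X (suc m))))
               (S.trans (S.*-congʳ {X (suc m)} (S.*-comm M G)) (S.*-assoc G M (X (suc m)))) m ⟩
        (G ∗ (M ∗ X (suc m))) m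
          ≈⟨ S.*-congˡ {G} (M∗X-suc m) m ⟩
        (G ∗ X m) m
          ≈⟨ coefficient-extraction m (c ∘ suc) m<N ⟩
        c (suc m) ∎

    composition-inversion : ∀ c → (∀ n → (_∘z·_ K c M) n ≈ M n) →
                            ∀ n .{{_ : NonZero n}} → c (suc n) ≈ - (recip n * (Q ↑ n) (suc n))
    composition-inversion c c∘zM≈M n = begin
      c (suc n)
        ≈⟨ coefficient-extraction (suc n) c (ℕ.n<1+n (suc n)) ⟨
      (partialComposition (suc (suc n)) c (z·_ K M) ∗ X (suc n)) (suc n)
        -- Only degrees up to `suc n` of the first factor matter; there the truncation agrees with
        -- C(zM), hence with `M`.
        ≈⟨ ∗-cong-≤ (suc n) {g = X (suc n)} (λ i i≤1+n → trans
             (partialComposition-stable c M (s≤s i≤1+n) (ℕ.n<1+n i)) (c∘zM≈M i)) (λ _ _ → refl) ⟩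
      (M ∗ X (suc n)) (suc n)
        ≈⟨ M∗X-suc n (suc n) ⟩
      X n (suc n)
        ≈⟨ ×-cancel n nX≈-q ⟩
      recip n * - q
        ≈⟨ -‿distribʳ-* (recip n) q ⟨
      - (recip n * q) ∎
      where
      q = (Q ↑ n) (suc n)
      nX≈-q : n × X n (suc n) ≈ - q
      -- As `suc n × q` is `q + n × q`, cancelling `n × q` leaves `n × X n (suc n) + q ≈ 0#`.
      nX≈-q = +-inverseˡ-unique _ _ (+-identityˡ-unique _ _ (begin
        (n × X n (suc n) + q) + n × q  ≈⟨ +-assoc _ _ _ ⟩
        n × X n (suc n) + suc n × q    ≈⟨ X-coefficient n (suc n) ⟩
        n × q                          ∎))

-- Weighted path sums and their decomposition at visits to 0.

module PathEnumeration {ℓ₁ ℓ₂} (K : RationalAlgebra ℓ₁ ℓ₂)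
  (a : ℕ → RationalAlgebra.Carrier K)
  (lam : (k : ℕ) → .{{NonZero k}} → RationalAlgebra.Carrier K) where
  open RationalAlgebra K hiding (zero)
  open PowerSeries K
  open SemiringMult semiring using (×-congˡ; ×-homo-+)
  open RingProperties ring using (-1*x≈-x; -‿distribˡ-*; -‿involutive)
  open NatSolver commutativeSemiring
  open SetoidReasoning setoid

  ∑ : ∀ {A : Set} → List A → (A → Carrier) → Carrier
  ∑ xs f = foldr _+_ 0# (map f xs)

  ∑-++ : ∀ {A : Set} (xs ys : List A) f → ∑ (xs ++ ys) f ≈ ∑ xs f + ∑ ys f
  ∑-++ []       ys f = sym (+-identityˡ _)
  ∑-++ (x ∷ xs) ys f = trans (+-congˡ (∑-++ xs ys f)) (sym (+-assoc _ _ _))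

  ∑-cong : ∀ {A : Set} (xs : List A) {f g} → (∀ x → f x ≈ g x) → ∑ xs f ≈ ∑ xs g
  ∑-cong []       f≈g = refl
  ∑-cong (x ∷ xs) f≈g = +-cong (f≈g x) (∑-cong xs f≈g)

  ∑-+ : ∀ {A : Set} (xs : List A) f g → ∑ xs (λ x → f x + g x) ≈ ∑ xs f + ∑ xs g
  ∑-+ []       f g = sym (+-identityˡ _)
  ∑-+ (x ∷ xs) f g = trans (+-congˡ (∑-+ xs f g))
    (solve 4 (λ p q r s → (p :+ q) :+ (r :+ s) := (p :+ r) :+ (q :+ s)) refl _ _ _ _)

  *-distribˡ-∑ : ∀ {A : Set} (xs : List A) c f → ∑ xs (λ x → c * f x) ≈ c * ∑ xs f
  *-distribˡ-∑ []       c f = sym (zeroʳ c)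
  *-distribˡ-∑ (x ∷ xs) c f = trans (+-congˡ (*-distribˡ-∑ xs c f)) (sym (distribˡ _ _ _))

  ∑-map : ∀ {A B : Set} (h : A → B) xs {f : B → Carrier} {g : A → Carrier} →
          (∀ x → f (h x) ≈ g x) → ∑ (map h xs) f ≈ ∑ xs g
  ∑-map h []       f∘h≈g = refl
  ∑-map h (x ∷ xs) f∘h≈g = +-cong (f∘h≈g x) (∑-map h xs f∘h≈g)

  -- `returns` and `value` extend `∣_∣₀` and `v` to all starting heights, since removing the first
  -- step may leave height 0.
  returns : ∀ {h n} → PathFrom h n → ℕ
  returns p = count (ℕ._≟ 0) (tail (heights p))

  value : ∀ {h n} → PathFrom h n → Carrier
  value {n = n} p = product {n} λ i → weight K a lam (step p i)

  -- With `g` arbitrary, the moments, the powers of `Q` and the cumulant formula are all instances,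
  -- and passing a return replaces `g` by `g ∘ suc`.
  pathSum : ℕ → (ℕ → Carrier) → Series K
  pathSum h g n = ∑ (pathsFrom n h) λ p → g (returns p) * value p

  -- Turns returns p into the number of all visits of p to 0, the starting point included.
  countStart : ℕ → (ℕ → Carrier) → ℕ → Carrier
  countStart zero    g = g ∘ suc
  countStart (suc _) g = g

  -- The start of `p`, ignored by `returns p`, is the endpoint of the new step and now counts if it
  -- is 0. Matching on it lets both sides compute.
  cons-term : ∀ {h h′ n} g (s : Step h h′) (p : PathFrom h′ n) →
              g (returns (cons s p)) * value (cons s p) ≈
              weight K a lam s * (countStart h′ g (returns p) * value p)
  cons-term g s (mkPath (zero ∷ hs)  ≡.refl e st) =
    solve 3 (λ p q r → p :* (q :* r) := q :* (p :* r)) refl _ _ _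
  cons-term g s (mkPath (suc h ∷ hs) ≡.refl e st) =
    solve 3 (λ p q r → p :* (q :* r) := q :* (p :* r)) refl _ _ _

  ∑-cons : ∀ {h h′} g (s : Step h h′) n →
           ∑ (map (cons s) (pathsFrom n h′)) (λ p → g (returns p) * value p) ≈
           weight K a lam s * pathSum h′ (countStart h′ g) n
  ∑-cons {h′ = h′} g s n = trans (∑-map (cons s) (pathsFrom n h′) (cons-term g s))
    (*-distribˡ-∑ (pathsFrom n h′) _ _)

  fallingSum : ℕ → (ℕ → Carrier) → Series K
  fallingSum zero    g n = 0#
  fallingSum (suc h) g n = lam (suc h) * pathSum h (countStart h g) n

  -- Decomposition by the first step; a rise never ends at 0, so its term keeps `g`.
  pathSum-suc : ∀ h g n → pathSum h g (suc n) ≈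
                pathSum (suc h) g n + (a h * pathSum h (countStart h g) n + fallingSum h g n)
  pathSum-suc h g n =
    trans (∑-++ (map (cons rise) (pathsFrom n (suc h))) _ _)
      (+-cong (trans (∑-cons g rise n) (*-identityˡ _))
        (trans (∑-++ (map (cons horizontal) (pathsFrom n h)) _ _)
          (+-cong (∑-cons g horizontal n) (falling h))))
    where
    falling : ∀ h → ∑ (fallingFrom n h) (λ p → g (returns p) * value p) ≈ fallingSum h g n
    falling zero    = refl
    falling (suc h) = ∑-cons g fall n

  -- The weighted paths from height h that reach 0 at their end and not before.
  firstPassage : ℕ → Series K
  firstPassage zero    n       = 1ₛ n
  firstPassage (suc h) zero    = 0#
  firstPassage (suc h) (suc n) =
    firstPassage (suc (suc h)) n +
    (a (suc h) * firstPassage (suc h) n + lam (suc h) * firstPassage h n)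

  -- Cut each path at its first visit to 0: that visit turns `g` into `g ∘ suc` for the remainder.
  -- The proof compares first-step recursions.
  pathSum-firstPassage : ∀ h g n → pathSum h (countStart h g) n ≈
                         (firstPassage h ∗ pathSum 0 (g ∘ suc)) n
  pathSum-firstPassage zero    g n       = sym (∗-identityˡ (pathSum 0 (g ∘ suc)) n)
  pathSum-firstPassage (suc h) g zero    = sym (trans (+-identityʳ _) (zeroˡ _))
  pathSum-firstPassage (suc h) g (suc n) = begin
    pathSum (suc h) g (suc n)
      ≈⟨ pathSum-suc (suc h) g n ⟩
    pathSum (suc (suc h)) g n +
      (a (suc h) * pathSum (suc h) g n + lam (suc h) * pathSum h (countStart h g) n)
      ≈⟨ +-cong (pathSum-firstPassage (suc (suc h)) g n) (+-cong
           (*-congˡ (pathSum-firstPassage (suc h) g n)) (*-congˡ (pathSum-firstPassage h g n))) ⟩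
    (F₂ ∗ E) n + (a (suc h) * (F₁ ∗ E) n + lam (suc h) * (F₀ ∗ E) n)
      ≈⟨ +-congˡ (+-cong (·-∗-assoc (a (suc h)) F₁ E n) (·-∗-assoc (lam (suc h)) F₀ E n)) ⟨
    (F₂ ∗ E) n + (((a (suc h) · F₁) ∗ E) n + ((lam (suc h) · F₀) ∗ E) n)
      ≈⟨ +-congˡ (∗-distribʳ E (a (suc h) · F₁) (lam (suc h) · F₀) n) ⟨
    (F₂ ∗ E) n + ((a (suc h) · F₁ ⊕ lam (suc h) · F₀) ∗ E) n
      ≈⟨ ∗-distribʳ E F₂ (a (suc h) · F₁ ⊕ lam (suc h) · F₀) n ⟨
    ((firstPassage (suc h) ∘ suc) ∗ E) n
      ≈⟨ trans (+-congʳ (zeroˡ _)) (+-identityˡ _) ⟨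
    (firstPassage (suc h) ∗ E) (suc n) ∎
    where
    E  = pathSum 0 (g ∘ suc)
    F₀ = firstPassage h
    F₁ = firstPassage (suc h)
    F₂ = firstPassage (suc (suc h))

  -- The series P of paths without intermediate returns.
  firstReturn : Series K
  firstReturn zero    = 0#
  firstReturn (suc n) = firstPassage 1 n + a 0 * 1ₛ n

  -- A path of positive length has a first return, where it is cut. Hence `g 0` does not occur on
  -- the right.
  renewal-suc : ∀ g n → pathSum 0 g (suc n) ≈ (firstReturn ∗ pathSum 0 (g ∘ suc)) (suc n)
  renewal-suc g n = begin
    pathSum 0 g (suc n)
      ≈⟨ pathSum-suc 0 g n ⟩
    pathSum 1 g n + (a 0 * E n + 0#)
      ≈⟨ +-cong (pathSum-firstPassage 1 g n)
           (trans (+-identityʳ _) (*-congˡ (sym (∗-identityˡ E n)))) ⟩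
    (firstPassage 1 ∗ E) n + a 0 * (1ₛ ∗ E) n
      ≈⟨ +-congˡ (·-∗-assoc (a 0) 1ₛ E n) ⟨
    (firstPassage 1 ∗ E) n + ((a 0 · 1ₛ) ∗ E) n
      ≈⟨ ∗-distribʳ E (firstPassage 1) (a 0 · 1ₛ) n ⟨
    ((firstReturn ∘ suc) ∗ E) n
      ≈⟨ trans (+-congʳ (zeroˡ _)) (+-identityˡ _) ⟨
    (firstReturn ∗ E) (suc n) ∎
    where E = pathSum 0 (g ∘ suc)

  -- The empty path supplies the term with `g 0`. For constant weight 1 this is M = 1 + P M.
  renewal : ∀ g → pathSum 0 g ≋ g 0 · 1ₛ ⊕ firstReturn ∗ pathSum 0 (g ∘ suc)
  renewal g zero    = +-congˡ (sym (trans (+-identityʳ _) (zeroˡ _)))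
  renewal g (suc n) = trans (renewal-suc g n)
    (trans (sym (+-identityˡ _)) (+-congʳ (sym (zeroʳ _))))

  pathSum-cong : ∀ {h g g′} → (∀ r → g r ≈ g′ r) → pathSum h g ≋ pathSum h g′
  pathSum-cong {h} g≈g′ n = ∑-cong (pathsFrom n h) λ p → *-congʳ (g≈g′ (returns p))

  pathSum-⊕ : ∀ h g g′ → pathSum h (λ r → g r + g′ r) ≋ pathSum h g ⊕ pathSum h g′
  pathSum-⊕ h g g′ n = trans (∑-cong (pathsFrom n h) (λ p → distribʳ _ _ _))
    (∑-+ (pathsFrom n h) _ _)

  pathSum-· : ∀ h x g → pathSum h (λ r → x * g r) ≋ x · pathSum h g
  pathSum-· h x g n = trans (∑-cong (pathsFrom n h) (λ p → *-assoc _ _ _))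
    (*-distribˡ-∑ (pathsFrom n h) x _)

  -- The moment series, its inverse and the binomial weights.

  moments : Series K
  moments = 1+Σ K (μ K a lam)

  moments≋pathSum : moments ≋ pathSum 0 (const 1#)
  moments≋pathSum zero    = sym (trans (+-identityʳ _) (*-identityˡ _))
  moments≋pathSum (suc n) = ∑-cong (𝓜 (suc n)) λ p → sym (*-identityˡ _)

  Q : Series K
  Q = 1ₛ S.- firstReturn

  Q∗ : ∀ f → Q ∗ f ≋ f S.- firstReturn ∗ f
  Q∗ f n = trans (S.[y-z]x≈yx-zx f 1ₛ firstReturn n) (+-congʳ (∗-identityˡ f n))

  Q∗moments≋1 : Q ∗ moments ≋ 1ₛ
  Q∗moments≋1 n = begin
    (Q ∗ moments) n                      ≈⟨ S.*-congˡ {Q} moments≋pathSum n ⟩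
    (Q ∗ E) n                            ≈⟨ Q∗ E n ⟩
    E n - (firstReturn ∗ E) n            ≈⟨ +-congʳ (renewal (const 1#) n) ⟩
    (1# * 1ₛ n + (firstReturn ∗ E) n) - (firstReturn ∗ E) n
      ≈⟨ trans (+-assoc _ _ _) (trans (+-congˡ (-‿inverseʳ _)) (+-identityʳ _)) ⟩
    1# * 1ₛ n                            ≈⟨ *-identityˡ _ ⟩
    1ₛ n                                 ∎
    where E = pathSum 0 (const 1#)

  -- The coefficient of xʳ in (1 - x)ᵐ.
  signedBinomial : ℕ → ℕ → Carrier
  signedBinomial m r = (- 1#) ^ r * ((m C r) × 1#)

  signedBinomial-0-suc : ∀ r → signedBinomial 0 (suc r) ≈ 0#
  signedBinomial-0-suc r = trans (*-congˡ (×-congˡ {1#} (k>n⇒nCk≡0 {0} {suc r} z<s))) (zeroʳ _)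

  -- Pascal's rule with signs, that is, multiplication by 1 - x.
  signedBinomial-suc : ∀ m r → signedBinomial (suc m) (suc r) ≈
                       signedBinomial m (suc r) + - 1# * signedBinomial m r
  signedBinomial-suc m r = begin
    - 1# * (- 1#) ^ r * ((suc m C suc r) × 1#)
      ≈⟨ *-congˡ (×-congˡ (nCk+nC[k+1]≡[n+1]C[k+1] m r)) ⟨
    - 1# * (- 1#) ^ r * ((m C r ℕ.+ m C suc r) × 1#)
      ≈⟨ *-congˡ (×-homo-+ 1# (m C r) (m C suc r)) ⟩
    - 1# * (- 1#) ^ r * ((m C r) × 1# + (m C suc r) × 1#)
      ≈⟨ solve 4 (λ p q x y → p :* q :* (x :+ y) := p :* q :* y :+ p :* (q :* x)) refl _ _ _ _ ⟩
    signedBinomial m (suc r) + - 1# * signedBinomial m r ∎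

  signedBinomial-m-0 : ∀ m → signedBinomial m 0 ≈ 1#
  signedBinomial-m-0 m = trans (*-identityˡ _) (+-identityʳ _)

  -- The binomial theorem for (1 - P)ᵐ without powers of P: after renewal, Pascal's rule splits off
  -- `P ∗ pathSum 0 b`, and the other terms recombine by renewal for `b`. For exponent 0 only the
  -- empty path survives.
  pathSum-signedBinomial : ∀ m → pathSum 0 (signedBinomial m) ≋ Q ↑ m
  pathSum-signedBinomial zero n = begin
    pathSum 0 (signedBinomial 0) n
      ≈⟨ renewal (signedBinomial 0) n ⟩
    signedBinomial 0 0 * 1ₛ n + (firstReturn ∗ pathSum 0 (signedBinomial 0 ∘ suc)) n
      ≈⟨ +-cong (trans (*-congʳ (signedBinomial-m-0 0)) (*-identityˡ _))
           (trans (S.*-comm firstReturn (pathSum 0 (signedBinomial 0 ∘ suc)) n)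
             (∗-zeroˡ firstReturn vanishing n)) ⟩
    1ₛ n + 0#  ≈⟨ +-identityʳ _ ⟩
    1ₛ n       ∎
    where
    vanishing : ∀ n → pathSum 0 (signedBinomial 0 ∘ suc) n ≈ 0#
    vanishing n = trans
      -- Zero is written as a product so that `pathSum-·` can extract a zero factor.
      (pathSum-cong {0} {signedBinomial 0 ∘ suc} {λ _ → 0# * 0#}
        (λ r → trans (signedBinomial-0-suc r) (sym (zeroˡ 0#))) n)
      (trans (pathSum-· 0 0# (const 0#) n) (zeroˡ _))
  pathSum-signedBinomial (suc m) n = begin
    pathSum 0 b′ n
      ≈⟨ renewal b′ n ⟩
    b′ 0 * 1ₛ n + (P ∗ pathSum 0 (b′ ∘ suc)) n
      ≈⟨ +-cong (*-congʳ (trans (signedBinomial-m-0 (suc m)) (sym (signedBinomial-m-0 m))))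
           (S.*-congˡ {P} step-down n) ⟩
    b 0 * 1ₛ n + (P ∗ (pathSum 0 (b ∘ suc) S.- pathSum 0 b)) n
      ≈⟨ +-congˡ (S.x[y-z]≈xy-xz P (pathSum 0 (b ∘ suc)) (pathSum 0 b) n) ⟩
    b 0 * 1ₛ n + ((P ∗ pathSum 0 (b ∘ suc)) n - (P ∗ pathSum 0 b) n)
      ≈⟨ +-assoc _ _ _ ⟨
    (b 0 * 1ₛ n + (P ∗ pathSum 0 (b ∘ suc)) n) - (P ∗ pathSum 0 b) n
      ≈⟨ +-congʳ (renewal b n) ⟨
    pathSum 0 b n - (P ∗ pathSum 0 b) n
      ≈⟨ Q∗ (pathSum 0 b) n ⟨
    (Q ∗ pathSum 0 b) n
      ≈⟨ S.*-congˡ {Q} (pathSum-signedBinomial m) n ⟩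
    (Q ↑ suc m) n ∎
    where
    P  = firstReturn
    b  = signedBinomial m
    b′ = signedBinomial (suc m)
    step-down : pathSum 0 (b′ ∘ suc) ≋ pathSum 0 (b ∘ suc) S.- pathSum 0 b
    step-down n = trans (pathSum-cong {0} (signedBinomial-suc m) n)
      (trans (pathSum-⊕ 0 (b ∘ suc) (λ r → - 1# * b r) n)
        (+-congˡ (trans (pathSum-· 0 (- 1#) b n) (-1*x≈-x _))))

  -- The exponents of -1 differ by one, which the sign of `recip m` absorbs. At 0 returns the
  -- truncated exponent would break this, hence `suc r`.
  coefficient≈signedBinomial : ∀ m .{{_ : NonZero m}} 1<1+m r →
    coefficient K (suc m) 1<1+m (suc r) ≈ (- recip m) * signedBinomial m (suc r)
  coefficient≈signedBinomial m 1<1+m r = begin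
    (- 1#) ^ r * recip m * x                   ≈⟨ *-congʳ (*-comm _ _) ⟩
    recip m * (- 1#) ^ r * x                   ≈⟨ *-congʳ (*-congʳ flip) ⟩
    (- recip m) * - 1# * (- 1#) ^ r * x
      ≈⟨ solve 4 (λ p q s t → p :* q :* s :* t := p :* (q :* s :* t)) refl _ _ _ _ ⟩
    (- recip m) * (- 1# * (- 1#) ^ r * x)      ∎
    where
    x = (m C suc r) × 1#
    flip : recip m ≈ (- recip m) * - 1#
    flip = begin
      recip m               ≈⟨ -‿involutive _ ⟨
      - (- recip m)         ≈⟨ -1*x≈-x _ ⟨
      - 1# * - recip m      ≈⟨ *-comm _ _ ⟩
      (- recip m) * - 1#    ∎

  pathSum-coefficient : ∀ m .{{_ : NonZero m}} 1<1+m →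
    pathSum 0 (coefficient K (suc m) 1<1+m) (suc m) ≈ - (recip m * (Q ↑ m) (suc m))
  pathSum-coefficient m 1<1+m = begin
    pathSum 0 g (suc m)
      ≈⟨ renewal-suc g m ⟩
    (firstReturn ∗ pathSum 0 (g ∘ suc)) (suc m)
      -- Splitting off the first return leaves only positive arguments of `g` and `g′`, where they
      -- agree.
      ≈⟨ S.*-congˡ {firstReturn} (pathSum-cong {0} (coefficient≈signedBinomial m 1<1+m)) (suc m) ⟩
    (firstReturn ∗ pathSum 0 (g′ ∘ suc)) (suc m)
      ≈⟨ renewal-suc g′ m ⟨
    pathSum 0 g′ (suc m)
      ≈⟨ pathSum-· 0 (- recip m) (signedBinomial m) (suc m) ⟩
    (- recip m) * pathSum 0 (signedBinomial m) (suc m)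
      ≈⟨ *-congˡ (pathSum-signedBinomial m (suc m)) ⟩
    (- recip m) * (Q ↑ m) (suc m)
      ≈⟨ -‿distribˡ-* _ _ ⟨
    - (recip m * (Q ↑ m) (suc m)) ∎
    where
    g  = coefficient K (suc m) 1<1+m
    g′ = λ r → (- recip m) * signedBinomial m r

mainTheorem1 : ∀ {ℓ₁ ℓ₂} (K : RationalAlgebra ℓ₁ ℓ₂) → let open RationalAlgebra K in
    (a : ℕ → Carrier) (lam : (k : ℕ) → .{{NonZero k}} → Carrier)
    (c : ℕ → Carrier) → FreeCumulants K (μ K a lam) c →
    (n : ℕ) (2≤n : 2 ≤ n) →
    c n ≈ Σ𝓜 K n (λ p → coefficient K n 2≤n ∣ p ∣₀ * v K a lam p)
mainTheorem1 K a lam c C∘zM≈M (suc zero) (s≤s ())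
mainTheorem1 K a lam c C∘zM≈M (suc m@(suc _)) 2≤n =
  -- `1+Σ K c` is `c` at positive indices, and the sum in the theorem unfolds to `pathSum 0`.
  trans (composition-inversion (1+Σ K c) C∘zM≈M m) (sym (pathSum-coefficient m 2≤n))
  where
  open RationalAlgebra K using (trans; sym)
  open PathEnumeration K a lam
  open PowerSeries.LagrangeInversion K moments Q Q∗moments≋1
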